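{- For any positive integer $m$ with $m\equiv 2\pmod 4$, the diagonal binary $\mathbb Z$-lattice $\ell=\langle 1,m\rangle$ is not recoverable.
   Context: A $\mathbb Z$-lattice is a free $\mathbb Z$-module $L$ of finite rank with a positive definite symmetric bilinear form $B:L\times L\to\mathbb Z$ (integral valued). $\langle a_1,\dots,a_k\rangle$ denotes the $\mathbb Z$-lattice with an orthogonal basis $x_1,\dots,x_k$ satisfying $B(x_i,x_i)=a_i$. A $\mathbb Z$-lattice $\ell$ is represented by $L$ if there is a $\mathbb Z$-linear map $\sigma:\ell\to L$ with $B(\sigma x,\sigma y)=B(x,y)$ for all $x,y\in\ell$. A $\mathbb Z$-lattice $\ell$ is recoverable if there is a finite set $\{\ell_1,\dots,\ell_t\}$ of proper sublattices of $\ell$ such that every $\mathbb Z$-lattice (of any rank) that represents all of $\ell_1,\dots,\ell_t$ also represents $\ell$. -}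

module Defs where

open import Algebra.Bundles using (AbelianGroup)
import Algebra.Construct.Pointwise as Pointwise
open import Algebra.Module.Bundles using (LeftModule)
open import Algebra.Module.Morphism.Structures
  using (IsLeftModuleHomomorphism; IsLeftModuleMonomorphism)
import Algebra.Properties.CommutativeMonoid.Sum as CommutativeMonoidSum
import Algebra.Properties.Semiring.Sum as SemiringSum
open import Data.Fin.Base using (Fin; zero; suc)
open import Data.Integer.Base
  using (ℤ; +_; -[1+_]; 0ℤ; 1ℤ; _+_; _*_; _<_; _≤_; +<+; +≤+)
open import Data.Integer.Properties as ℤ using (+-*-ring; +-*-semiring)
open import Data.Nat.Base as ℕ using (ℕ; NonZero)
open import Data.Product.Base using (∃-syntax; Σ-syntax; _,_)
open import Data.Vec.Functional using (Vector; []; _∷_)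
open import Function.Definitions using (Surjective)
open import Level using (0ℓ)
open import Relation.Binary.PropositionalEquality
  using (_≡_; refl; sym; trans; cong; cong₂; subst; module ≡-Reasoning)
open import Relation.Nullary using (¬_; yes; no; contradiction)

open SemiringSum +-*-semiring using (sum; sum-cong-≗; ∑-distrib-+; *-distribˡ-sum)

module _ (M : LeftModule +-*-ring 0ℓ 0ℓ) where
  open LeftModule M

  linearCombination : ∀ {n} → Vector ℤ n → Vector Carrierᴹ n → Carrierᴹ
  linearCombination c b =
    CommutativeMonoidSum.sum +ᴹ-commutativeMonoid (λ i → c i *ₗ b i)

  record IsBasis {n} (b : Vector Carrierᴹ n) : Set where
    field
      spanning    : ∀ x → ∃[ c ] x ≈ᴹ linearCombination c b
      independent : ∀ c → linearCombination c b ≈ᴹ 0ᴹ → ∀ i → c i ≡ 0ℤ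

record ℤ-Lattice : Set₁ where
  field
    leftModule : LeftModule +-*-ring 0ℓ 0ℓ

  open LeftModule leftModule public

  field
    rank    : ℕ
    basis   : Vector Carrierᴹ rank
    isBasis : IsBasis leftModule basis

    -- Linearity in the second argument follows from symmetry.
    B          : Carrierᴹ → Carrierᴹ → ℤ
    B-cong     : ∀ {x x′ y y′} → x ≈ᴹ x′ → y ≈ᴹ y′ → B x y ≡ B x′ y′
    B-sym      : ∀ x y → B x y ≡ B y x
    B-+ˡ       : ∀ x y z → B (x +ᴹ y) z ≡ B x z + B y z
    B-*ˡ       : ∀ a x y → B (a *ₗ x) y ≡ a * B x y
    B-positive : ∀ x → ¬ (x ≈ᴹ 0ᴹ) → 0ℤ < B x x

module _ (K L : ℤ-Lattice) where
  private
    module K = ℤ-Lattice K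
    module L = ℤ-Lattice L

  record Representation : Set where
    field
      σ                        : K.Carrierᴹ → L.Carrierᴹ
      isLeftModuleHomomorphism : IsLeftModuleHomomorphism K.rawLeftModule L.rawLeftModule σ
      B-homo                   : ∀ x y → L.B (σ x) (σ y) ≡ K.B x y

-- Every submodule of a ℤ-lattice is again free of finite rank, so a
-- sublattice is presented as a ℤ-lattice with an isometric embedding, and is
-- identified with the image.  Its rank may be smaller than that of L.
record ProperSublattice (L : ℤ-Lattice) : Set₁ where
  private
    module L = ℤ-Lattice L

  field
    lattice : ℤ-Lattice

  private
    module K = ℤ-Lattice lattice

  field
    ι                        : K.Carrierᴹ → L.Carrierᴹ
    isLeftModuleMonomorphism : IsLeftModuleMonomorphism K.rawLeftModule L.rawLeftModule ι
    B-homo                   : ∀ x y → L.B (ι x) (ι y) ≡ K.B x y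
    proper                   : ¬ Surjective K._≈ᴹ_ L._≈ᴹ_ ι

Recoverable : ℤ-Lattice → Set₁
Recoverable ℓ =
  ∃[ t ] Σ[ ℓᵢ ∈ Vector (ProperSublattice ℓ) t ]
    (∀ (L : ℤ-Lattice) →
      (∀ i → Representation (ProperSublattice.lattice (ℓᵢ i)) L) →
      Representation ℓ L)

ℤ^_ : ℕ → LeftModule +-*-ring 0ℓ 0ℓ
ℤ^ k = record
  { Carrierᴹ     = Vector ℤ k
  ; _≈ᴹ_         = G._≈_
  ; _+ᴹ_         = G._∙_
  ; _*ₗ_         = λ a x i → a * x i
  ; 0ᴹ           = G.ε
  ; -ᴹ_          = G._⁻¹
  ; isLeftModule = record
    { isLeftSemimodule = record
      { +ᴹ-isCommutativeMonoid = G.isCommutativeMonoid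
      ; isPreleftSemimodule    = record
        { *ₗ-cong      = λ a≡b x≈y i → cong₂ _*_ a≡b (x≈y i)
        ; *ₗ-zeroˡ     = λ x i → ℤ.*-zeroˡ (x i)
        ; *ₗ-distribʳ  = λ x a b i → ℤ.*-distribʳ-+ (x i) a b
        ; *ₗ-identityˡ = λ x i → ℤ.*-identityˡ (x i)
        ; *ₗ-assoc     = λ a b x i → ℤ.*-assoc a b (x i)
        ; *ₗ-zeroʳ     = λ a i → ℤ.*-zeroʳ a
        ; *ₗ-distribˡ  = λ a x y i → ℤ.*-distribˡ-+ a (x i) (y i)
        }
      }
    ; -ᴹ‿cong    = G.⁻¹-cong
    ; -ᴹ‿inverse = G.inverse
    }
  }
  where module G = AbelianGroup (Pointwise.abelianGroup (Fin k) ℤ.+-0-abelianGroup)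

standardBasis : ∀ {k} → Vector (Vector ℤ k) k
standardBasis zero    zero    = 1ℤ
standardBasis zero    (suc j) = 0ℤ
standardBasis (suc i) zero    = 0ℤ
standardBasis (suc i) (suc j) = standardBasis i j

sum-zero : ∀ {n} (f : Vector ℤ n) → (∀ i → f i ≡ 0ℤ) → sum f ≡ 0ℤ
sum-zero {ℕ.zero}  f f≡0 = refl
sum-zero {ℕ.suc n} f f≡0 = cong₂ _+_ (f≡0 zero) (sum-zero (λ i → f (suc i)) (λ i → f≡0 (suc i)))

sum-standardBasis : ∀ {n} (c : Vector ℤ n) j → sum (λ i → c i * standardBasis i j) ≡ c j
sum-standardBasis c zero    = trans
  (cong₂ _+_ (ℤ.*-identityʳ (c zero)) (sum-zero _ (λ i → ℤ.*-zeroʳ (c (suc i)))))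
  (ℤ.+-identityʳ (c zero))
sum-standardBasis c (suc j) = trans
  (cong₂ _+_ (ℤ.*-zeroʳ (c zero)) (sum-standardBasis (λ i → c (suc i)) j))
  (ℤ.+-identityˡ (c (suc j)))

module _ (k : ℕ) where
  open LeftModule (ℤ^ k) using (+ᴹ-commutativeMonoid)

  sum-pointwise : ∀ {n} (f : Vector (Vector ℤ k) n) j →
    CommutativeMonoidSum.sum +ᴹ-commutativeMonoid f j ≡ sum (λ i → f i j)
  sum-pointwise {ℕ.zero}  f j = refl
  sum-pointwise {ℕ.suc n} f j = cong (λ s → f zero j + s) (sum-pointwise (λ i → f (suc i)) j)

linearCombination-standardBasis : ∀ {k} (c : Vector ℤ k) j →
  linearCombination (ℤ^ k) c standardBasis j ≡ c j
linearCombination-standardBasis {k} c j =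
  trans (sum-pointwise k (λ i l → c i * standardBasis i l) j) (sum-standardBasis c j)

square-nonNegative : ∀ x → 0ℤ ≤ x * x
square-nonNegative (+ n)    = subst (0ℤ ≤_) (ℤ.pos-* n n) (+≤+ ℕ.z≤n)
square-nonNegative -[1+ n ] = +≤+ ℕ.z≤n

square-positive : ∀ x → ¬ x ≡ 0ℤ → 0ℤ < x * x
square-positive (+ ℕ.zero)  x≢0 = contradiction refl x≢0
square-positive (+ ℕ.suc n) x≢0 = +<+ (ℕ.s≤s ℕ.z≤n)
square-positive -[1+ n ]    x≢0 = +<+ (ℕ.s≤s ℕ.z≤n)

standardBasis-isBasis : ∀ {k} → IsBasis (ℤ^ k) standardBasis
standardBasis-isBasis = record
  { spanning    = λ x → x , λ j → sym (linearCombination-standardBasis x j)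
  ; independent = λ c c≈0 j → trans (sym (linearCombination-standardBasis c j)) (c≈0 j)
  }

diagonalForm : ∀ {k} → Vector ℕ k → Vector ℤ k → Vector ℤ k → ℤ
diagonalForm a x y = sum (λ i → + a i * (x i * y i))

term-nonNegative : ∀ a x → 0ℤ ≤ + a * (x * x)
term-nonNegative a x =
  subst (_≤ + a * (x * x)) (ℤ.*-zeroʳ (+ a)) (ℤ.*-monoˡ-≤-nonNeg (+ a) (square-nonNegative x))

term-positive : ∀ a x → NonZero a → ¬ x ≡ 0ℤ → 0ℤ < + a * (x * x)
term-positive (ℕ.suc a) x _ x≢0 =
  subst (_< + ℕ.suc a * (x * x)) (ℤ.*-zeroʳ (+ ℕ.suc a))
    (ℤ.*-monoˡ-<-pos (+ ℕ.suc a) (square-positive x x≢0))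

diagonalForm-nonNegative : ∀ {k} (a : Vector ℕ k) x → 0ℤ ≤ diagonalForm a x x
diagonalForm-nonNegative {ℕ.zero}  a x = ℤ.≤-refl
diagonalForm-nonNegative {ℕ.suc k} a x =
  ℤ.+-mono-≤ (term-nonNegative (a zero) (x zero))
    (diagonalForm-nonNegative (λ i → a (suc i)) (λ i → x (suc i)))

diagonalForm-positive : ∀ {k} (a : Vector ℕ k) → (∀ i → NonZero (a i)) →
  ∀ x → ¬ (∀ i → x i ≡ 0ℤ) → 0ℤ < diagonalForm a x x
diagonalForm-positive {ℕ.zero}  a a≢0 x x≢0 = contradiction (λ ()) x≢0
diagonalForm-positive {ℕ.suc k} a a≢0 x x≢0 with x zero ℤ.≟ 0ℤ
... | no x₀≢0  = ℤ.+-mono-<-≤ (term-positive (a zero) (x zero) (a≢0 zero) x₀≢0)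
                   (diagonalForm-nonNegative (λ i → a (suc i)) (λ i → x (suc i)))
... | yes x₀≡0 = ℤ.+-mono-≤-< (term-nonNegative (a zero) (x zero))
                   (diagonalForm-positive (λ i → a (suc i)) (λ i → a≢0 (suc i)) (λ i → x (suc i)) tail≢0)
  where
  tail≢0 : ¬ (∀ i → x (suc i) ≡ 0ℤ)
  tail≢0 tail≡0 = x≢0 λ { zero → x₀≡0 ; (suc i) → tail≡0 i }

diagonalForm-sym : ∀ {k} (a : Vector ℕ k) x y → diagonalForm a x y ≡ diagonalForm a y x
diagonalForm-sym a x y = sum-cong-≗ (λ i → cong (+ a i *_) (ℤ.*-comm (x i) (y i)))

diagonalForm-+ˡ : ∀ {k} (a : Vector ℕ k) x y z →
  diagonalForm a (λ i → x i + y i) z ≡ diagonalForm a x z + diagonalForm a y z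
diagonalForm-+ˡ a x y z = trans
  (sum-cong-≗ (λ i → trans
    (cong (+ a i *_) (ℤ.*-distribʳ-+ (z i) (x i) (y i)))
    (ℤ.*-distribˡ-+ (+ a i) (x i * z i) (y i * z i))))
  (∑-distrib-+ (λ i → + a i * (x i * z i)) (λ i → + a i * (y i * z i)))

diagonalForm-*ˡ : ∀ {k} (a : Vector ℕ k) b x y →
  diagonalForm a (λ i → b * x i) y ≡ b * diagonalForm a x y
diagonalForm-*ˡ a b x y = trans
  (sum-cong-≗ (λ i → begin
    + a i * (b * x i * y i)   ≡⟨ cong (+ a i *_) (ℤ.*-assoc b (x i) (y i)) ⟩
    + a i * (b * (x i * y i)) ≡⟨ ℤ.*-assoc (+ a i) b _ ⟨
    + a i * b * (x i * y i)   ≡⟨ cong (_* (x i * y i)) (ℤ.*-comm (+ a i) b) ⟩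
    b * + a i * (x i * y i)   ≡⟨ ℤ.*-assoc b (+ a i) _ ⟩
    b * (+ a i * (x i * y i)) ∎))
  (sym (*-distribˡ-sum b (λ i → + a i * (x i * y i))))
  where open ≡-Reasoning

diagonal : ∀ {k} (a : Vector ℕ k) → (∀ i → NonZero (a i)) → ℤ-Lattice
diagonal {k} a a≢0 = record
  { leftModule = ℤ^ k
  ; rank       = k
  ; basis      = standardBasis
  ; isBasis    = standardBasis-isBasis
  ; B          = diagonalForm a
  ; B-cong     = λ x≈x′ y≈y′ → sum-cong-≗ (λ i → cong (+ a i *_) (cong₂ _*_ (x≈x′ i) (y≈y′ i)))
  ; B-sym      = diagonalForm-sym a
  ; B-+ˡ       = diagonalForm-+ˡ a
  ; B-*ˡ       = diagonalForm-*ˡ a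
  ; B-positive = diagonalForm-positive a a≢0
  }

⟨_,_⟩ : (a b : ℕ) .{{_ : NonZero a}} .{{_ : NonZero b}} → ℤ-Lattice
⟨ a , b ⟩ = diagonal (a ∷ b ∷ []) nonZero
  where
  nonZero : ∀ i → NonZero ((a ∷ b ∷ []) i)
  nonZero zero       = ℕ.≢-nonZero (ℕ.≢-nonZero⁻¹ a)
  nonZero (suc zero) = ℕ.≢-nonZero (ℕ.≢-nonZero⁻¹ b)

{-# OPTIONS --safe #-}

-- A proper sublattice of ⟨1,m⟩, in coordinates (X , Y), satisfies n ∣ Y or
-- X ≡ kY (mod n) for some n ≥ 2.  Each sublattice of this shape embeds into
-- ⟨1,m−1⟩ ⊥ p for a binary lattice p whose nonzero norms are "good": divisible
-- by 4, greater than m, or equal to m−1 with m > 2.  Good numbers are closed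
-- under addition and include neither 1 nor m.  So for finitely many sublattices
-- the lattice L = ⟨1,m−1⟩ ⊥ p₁ ⊥ … ⊥ pₜ represents all of them.  If L represented
-- ⟨1,m⟩, the vector of norm 1 would lie in ⟨1,m−1⟩, and the orthogonal vector would
-- give m = (m−1)z² + N with N zero or good, which is impossible.
module Submission where

open import Algebra.Module.Bundles using (LeftModule)
open import Algebra.Module.Morphism.Structures
  using (IsLeftModuleHomomorphism; IsLeftModuleMonomorphism)
open import Data.Fin.Base using (Fin; zero; suc)
open import Data.Fin.Properties using (sequence)
open import Data.Integer.Base
  using (ℤ; +_; +0; +[1+_]; -[1+_]; 0ℤ; 1ℤ; _+_; _*_; _-_; -_; ∣_∣; _≤_; _<_; +≤+; +<+;
         nonNegative; positive)
open import Data.Integer.Divisibility.Signed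
  using (_∣_; divides; quotient; ∣⇒∣ᵤ; ∣m∣n⇒∣m+n; ∣m⇒∣m*n)
open import Data.Integer.DivMod using (_/ℕ_; _%ℕ_; n%ℕd<d; a≡a%ℕn+[a/ℕn]*n)
import Data.Integer.Properties as ℤ
open import Data.Integer.Tactic.RingSolver using (solve-∀)
open import Data.Nat.Base as ℕ using (ℕ; NonZero; _%_; zero; suc; z≤n; s≤s)
import Data.Nat.Divisibility as ℕ
import Data.Nat.DivMod as ℕ
open import Data.Nat.Induction using (<-rec)
import Data.Nat.Properties as ℕ
open import Data.Product.Base using (∃-syntax; _×_; _,_; proj₁; proj₂)
open import Data.Sum.Base using (_⊎_; inj₁; inj₂)
open import Data.Vec.Functional using (Vector; _∷_; tail)
open import Defs
open import Effect.Monad using (RawMonad)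
open import Level using (0ℓ)
open import Relation.Binary.PropositionalEquality
  using (_≡_; refl; sym; trans; cong; cong₂; subst; subst₂; module ≡-Reasoning)
open import Relation.Nullary using (¬_; yes; no; contradiction)
open import Relation.Nullary.Decidable using (from-no; _×-dec_; ¬¬-excluded-middle)
open import Relation.Nullary.Negation using (¬¬-Monad; ¬¬-map)

-- Integer inequalities, squares and parity.

0≤* : ∀ {i j} → 0ℤ ≤ i → 0ℤ ≤ j → 0ℤ ≤ i * j
0≤* {i} {j} 0≤i 0≤j =
  subst (_≤ i * j) (ℤ.*-zeroʳ i) (ℤ.*-monoˡ-≤-nonNeg i {{nonNegative 0≤i}} 0≤j)

0<* : ∀ {i j} → 0ℤ < i → 0ℤ < j → 0ℤ < i * j
0<* {i} {j} 0<i 0<j =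
  subst (_< i * j) (ℤ.*-zeroʳ i) (ℤ.*-monoˡ-<-pos i {{positive 0<i}} 0<j)

<-offset : ∀ {i j} d → j ≡ i + d → 0ℤ < d → i < j
<-offset {i} {j} d j≡i+d 0<d =
  subst₂ _<_ (ℤ.+-identityʳ i) (sym j≡i+d) (ℤ.+-monoʳ-< i 0<d)

square≡∣∣² : ∀ x → x * x ≡ + (∣ x ∣ ℕ.* ∣ x ∣)
square≡∣∣² (+ n)    = sym (ℤ.pos-* n n)
square≡∣∣² -[1+ n ] = refl

∣∣≤⇒square≤ : ∀ x y → ∣ x ∣ ℕ.≤ ∣ y ∣ → x * x ≤ y * y
∣∣≤⇒square≤ x y ∣x∣≤∣y∣ = subst₂ _≤_ (sym (square≡∣∣² x)) (sym (square≡∣∣² y))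
  (+≤+ (ℕ.*-mono-≤ ∣x∣≤∣y∣ ∣x∣≤∣y∣))

1≤square : ∀ {x} → ¬ x ≡ 0ℤ → 1ℤ ≤ x * x
1≤square {x} x≢0 = ℤ.i<j⇒suc[i]≤j (square-positive x x≢0)

0≤square-1 : ∀ {x} → ¬ x ≡ 0ℤ → 0ℤ ≤ x * x - 1ℤ
0≤square-1 x≢0 = ℤ.i≤j⇒0≤j-i (1≤square x≢0)

0≤square-4 : ∀ {x} → 2 ℕ.≤ ∣ x ∣ → 0ℤ ≤ x * x - + 4
0≤square-4 {x} 2≤∣x∣ = ℤ.i≤j⇒0≤j-i (∣∣≤⇒square≤ (+ 2) x 2≤∣x∣)

square≡1⊎2≤∣∣ : ∀ y → ¬ y ≡ 0ℤ → y * y ≡ 1ℤ ⊎ 2 ℕ.≤ ∣ y ∣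
square≡1⊎2≤∣∣ (+ 0)           y≢0 = contradiction refl y≢0
square≡1⊎2≤∣∣ (+ 1)           _   = inj₁ refl
square≡1⊎2≤∣∣ +[1+ suc _ ]    _   = inj₂ (s≤s (s≤s z≤n))
square≡1⊎2≤∣∣ -[1+ 0 ]        _   = inj₁ refl
square≡1⊎2≤∣∣ -[1+ suc _ ]    _   = inj₂ (s≤s (s≤s z≤n))

0<sumOfSquares : ∀ x y → ¬ (x ≡ 0ℤ × y ≡ 0ℤ) → 0ℤ < x * x + y * y
0<sumOfSquares x y xy≢0 with x ℤ.≟ 0ℤ
... | no x≢0 = ℤ.+-mono-<-≤ (square-positive x x≢0) (square-nonNegative y)
... | yes x≡0 =
  ℤ.+-mono-≤-< (square-nonNegative x) (square-positive y λ y≡0 → xy≢0 (x≡0 , y≡0))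

parity : ∀ n → ∃[ ε ] ∃[ h ] ε ℕ.≤ 1 × n ≡ ε ℕ.+ h ℕ.* 2
parity n = n % 2 , n ℕ./ 2 , ℕ.≤-pred (ℕ.m%n<n n 2) , ℕ.m≡m%n+[m/n]*n n 2

-- Squares are 0 or 1 modulo 4, according to parity. Once `ε` copies of a square are moved into the
-- norm 1 coordinate of ⟨1, m - 1⟩, the norms left on the axis y = 0 become multiples of 4.
4∣n²-ε : ∀ {n} ε h → ε ℕ.≤ 1 → n ≡ ε ℕ.+ h ℕ.* 2 → + 4 ∣ + n * + n - + ε
4∣n²-ε zero h _ refl = divides (+ h * + h)
  (trans (cong (λ i → i * i - 0ℤ) (ℤ.pos-* h 2)) (identity (+ h)))
  where
  identity : ∀ h → h * + 2 * (h * + 2) - 0ℤ ≡ h * h * + 4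
  identity = solve-∀
4∣n²-ε (suc zero) h _ refl = divides (+ h * + h + + h)
  (trans (cong (λ i → (1ℤ + i) * (1ℤ + i) - 1ℤ) (ℤ.pos-* h 2)) (identity (+ h)))
  where
  identity : ∀ h → (1ℤ + h * + 2) * (1ℤ + h * + 2) - 1ℤ ≡ (h * h + h) * + 4
  identity = solve-∀
4∣n²-ε (suc (suc _)) _ (s≤s ()) _

-- Binary symmetric bilinear forms.

record Gram : Set where
  constructor gram
  field
    A b C : ℤ

  form : ℤ → ℤ → ℤ → ℤ → ℤ
  form x y x′ y′ = A * (x * x′) + b * (x * y′ + y * x′) + C * (y * y′)

  norm : ℤ → ℤ → ℤ
  norm x y = form x y x y

open Gram using (form; norm)

form-cong : ∀ g {x y x′ y′ u v u′ v′} → x ≡ u → y ≡ v → x′ ≡ u′ → y′ ≡ v′ →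
  form g x y x′ y′ ≡ form g u v u′ v′
form-cong g refl refl refl refl = refl

form-zero : ∀ g → norm g 0ℤ 0ℤ ≡ 0ℤ
form-zero (gram A b C) = identity A b C
  where
  identity : ∀ A b C → A * 0ℤ + b * 0ℤ + C * 0ℤ ≡ 0ℤ
  identity = solve-∀

-- Integer-valued linear functionals.

module _ (M : LeftModule ℤ.+-*-ring 0ℓ 0ℓ) where
  open LeftModule M

  -- Lattice maps are handled one integer coordinate at a time: coordinates are built with the
  -- closure lemmas below and reassembled by `vector-homomorphism`.
  record IsLinear (f : Carrierᴹ → ℤ) : Set where
    field
      cong-≈ : ∀ {u w} → u ≈ᴹ w → f u ≡ f w
      +-homo : ∀ u w → f (u +ᴹ w) ≡ f u + f w
      *-homo : ∀ c u → f (c *ₗ u) ≡ c * f u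

    0-homo : f 0ᴹ ≡ 0ℤ
    0-homo = trans (cong-≈ (≈ᴹ-sym (*ₗ-zeroˡ 0ᴹ))) (trans (*-homo 0ℤ 0ᴹ) (ℤ.*-zeroˡ (f 0ᴹ)))

    -‿homo : ∀ u → f (-ᴹ u) ≡ - f u
    -‿homo u = ℤ-inverse (trans (sym (+-homo (-ᴹ u) u)) (trans (cong-≈ (-ᴹ‿inverseˡ u)) 0-homo))
      where
      identity : ∀ i j → i ≡ i + j - j
      identity = solve-∀
      ℤ-inverse : ∀ {i j} → i + j ≡ 0ℤ → i ≡ - j
      ℤ-inverse {i} {j} i+j≡0 =
        trans (identity i j) (trans (cong (_- j) i+j≡0) (ℤ.+-identityˡ (- j)))

module _ {M : LeftModule ℤ.+-*-ring 0ℓ 0ℓ} where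
  open LeftModule M

  zero-linear : IsLinear M (λ _ → 0ℤ)
  zero-linear = record
    { cong-≈ = λ _ → refl ; +-homo = λ _ _ → refl ; *-homo = λ c _ → sym (ℤ.*-zeroʳ c) }

  +-linear : ∀ {f g} → IsLinear M f → IsLinear M g → IsLinear M (λ w → f w + g w)
  +-linear {f} {g} lf lg = record
    { cong-≈ = λ u≈w → cong₂ _+_ (F.cong-≈ u≈w) (G.cong-≈ u≈w)
    ; +-homo = λ u w → trans (cong₂ _+_ (F.+-homo u w) (G.+-homo u w)) (swap (f u) (f w) (g u) (g w))
    ; *-homo = λ c u → trans (cong₂ _+_ (F.*-homo c u) (G.*-homo c u)) (sym (ℤ.*-distribˡ-+ c (f u) (g u)))
    }
    where
    module F = IsLinear lf
    module G = IsLinear lg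
    swap : ∀ a b c d → a + b + (c + d) ≡ a + c + (b + d)
    swap = solve-∀

  scale-linear : ∀ k {f} → IsLinear M f → IsLinear M (λ w → k * f w)
  scale-linear k {f} lf = record
    { cong-≈ = λ u≈w → cong (k *_) (F.cong-≈ u≈w)
    ; +-homo = λ u w → trans (cong (k *_) (F.+-homo u w)) (ℤ.*-distribˡ-+ k (f u) (f w))
    ; *-homo = λ c u → trans (cong (k *_) (F.*-homo c u)) (swap k c (f u))
    }
    where
    module F = IsLinear lf
    swap : ∀ a b c → a * (b * c) ≡ b * (a * c)
    swap = solve-∀

  -- Multiplication by a nonzero `n` is injective on ℤ, so each law for `q` may be checked after
  -- multiplying by `n`, where it is a law for `f`.
  quotient-linear : ∀ n .{{_ : ℕ.NonZero n}} {f q} → IsLinear M f → (∀ w → f w ≡ q w * + n) → IsLinear M q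
  quotient-linear n@(suc _) {f} {q} lf f≡qn = record
    { cong-≈ = λ {u} {w} u≈w → cancel (trans (sym (f≡qn u)) (trans (F.cong-≈ u≈w) (f≡qn w)))
    ; +-homo = λ u w → cancel (begin
        q (u +ᴹ w) * + n        ≡⟨ f≡qn (u +ᴹ w) ⟨
        f (u +ᴹ w)              ≡⟨ F.+-homo u w ⟩
        f u + f w               ≡⟨ cong₂ _+_ (f≡qn u) (f≡qn w) ⟩
        q u * + n + q w * + n   ≡⟨ ℤ.*-distribʳ-+ (+ n) (q u) (q w) ⟨
        (q u + q w) * + n       ∎)
    ; *-homo = λ c u → cancel (begin
        q (c *ₗ u) * + n   ≡⟨ f≡qn (c *ₗ u) ⟨
        f (c *ₗ u)         ≡⟨ F.*-homo c u ⟩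
        c * f u            ≡⟨ cong (c *_) (f≡qn u) ⟩
        c * (q u * + n)    ≡⟨ ℤ.*-assoc c (q u) (+ n) ⟨
        c * q u * + n      ∎)
    }
    where
    open ≡-Reasoning
    module F = IsLinear lf
    cancel : ∀ {i j} → i * + n ≡ j * + n → i ≡ j
    cancel {i} {j} = ℤ.*-cancelʳ-≡ i j (+ n)

  vector-homomorphism : ∀ {k} {σ : Carrierᴹ → Vector ℤ k} → (∀ j → IsLinear M (λ w → σ w j)) →
    IsLeftModuleHomomorphism rawLeftModule (LeftModule.rawLeftModule (ℤ^ k)) σ
  vector-homomorphism linear = record
    { +ᴹ-isGroupHomomorphism = record
      { isMonoidHomomorphism = record
        { isMagmaHomomorphism = record
          { isRelHomomorphism = record { cong = λ u≈w j → IsLinear.cong-≈ (linear j) u≈w }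
          ; homo = λ u w j → IsLinear.+-homo (linear j) u w
          }
        ; ε-homo = λ j → IsLinear.0-homo (linear j)
        }
      ; ⁻¹-homo = λ u j → IsLinear.-‿homo (linear j) u
      }
    ; *ₗ-homo = λ c u j → IsLinear.*-homo (linear j) c u
    }

-- Orthogonal sums of binary forms.

-- Coordinates come in consecutive pairs, one pair per summand. The length is written `t ℕ.* 2`
-- because `suc t ℕ.* 2` then computes to two successors.
gramForm : ∀ {t} → Vector Gram t → Vector ℤ (t ℕ.* 2) → Vector ℤ (t ℕ.* 2) → ℤ
gramForm {zero}  gs x y = 0ℤ
gramForm {suc t} gs x y =
  form (gs zero) (x zero) (x (suc zero)) (y zero) (y (suc zero)) +
  gramForm (tail gs) (tail (tail x)) (tail (tail y))

gramForm-cong : ∀ {t} (gs : Vector Gram t) {x x′ y y′} →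
  (∀ j → x j ≡ x′ j) → (∀ j → y j ≡ y′ j) → gramForm gs x y ≡ gramForm gs x′ y′
gramForm-cong {zero}  gs x≈x′ y≈y′ = refl
gramForm-cong {suc t} gs x≈x′ y≈y′ = cong₂ _+_
  (form-cong (gs zero) (x≈x′ zero) (x≈x′ (suc zero)) (y≈y′ zero) (y≈y′ (suc zero)))
  (gramForm-cong (tail gs) (λ j → x≈x′ (suc (suc j))) (λ j → y≈y′ (suc (suc j))))

gramForm-sym : ∀ {t} (gs : Vector Gram t) x y → gramForm gs x y ≡ gramForm gs y x
gramForm-sym {zero}  gs x y = refl
gramForm-sym {suc t} gs x y = cong₂ _+_
  (identity A b C (x zero) (x (suc zero)) (y zero) (y (suc zero)))
  (gramForm-sym (tail gs) (tail (tail x)) (tail (tail y)))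
  where
  open Gram (gs zero) using (A; b; C)
  identity : ∀ A b C x y x′ y′ →
    A * (x * x′) + b * (x * y′ + y * x′) + C * (y * y′) ≡
    A * (x′ * x) + b * (x′ * y + y′ * x) + C * (y′ * y)
  identity = solve-∀

gramForm-+ˡ : ∀ {t} (gs : Vector Gram t) x y z →
  gramForm gs (λ j → x j + y j) z ≡ gramForm gs x z + gramForm gs y z
gramForm-+ˡ {zero}  gs x y z = refl
gramForm-+ˡ {suc t} gs x y z = trans
  (cong (λ i → form (gs zero) (x zero + y zero) (x (suc zero) + y (suc zero)) (z zero) (z (suc zero)) + i)
    (gramForm-+ˡ (tail gs) (tail (tail x)) (tail (tail y)) (tail (tail z))))
  (identity A b C (x zero) (x (suc zero)) (y zero) (y (suc zero)) (z zero) (z (suc zero)) _ _)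
  where
  open Gram (gs zero) using (A; b; C)
  identity : ∀ A b C x₀ x₁ y₀ y₁ z₀ z₁ i j →
    A * ((x₀ + y₀) * z₀) + b * ((x₀ + y₀) * z₁ + (x₁ + y₁) * z₀) + C * ((x₁ + y₁) * z₁) + (i + j) ≡
    (A * (x₀ * z₀) + b * (x₀ * z₁ + x₁ * z₀) + C * (x₁ * z₁) + i) +
    (A * (y₀ * z₀) + b * (y₀ * z₁ + y₁ * z₀) + C * (y₁ * z₁) + j)
  identity = solve-∀

gramForm-*ˡ : ∀ {t} (gs : Vector Gram t) c x y →
  gramForm gs (λ j → c * x j) y ≡ c * gramForm gs x y
gramForm-*ˡ {zero}  gs c x y = sym (ℤ.*-zeroʳ c)
gramForm-*ˡ {suc t} gs c x y = trans
  (cong (λ i → form (gs zero) (c * x zero) (c * x (suc zero)) (y zero) (y (suc zero)) + i)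
    (gramForm-*ˡ (tail gs) c (tail (tail x)) (tail (tail y))))
  (identity A b C c (x zero) (x (suc zero)) (y zero) (y (suc zero)) _)
  where
  open Gram (gs zero) using (A; b; C)
  identity : ∀ A b C c x₀ x₁ y₀ y₁ i →
    A * (c * x₀ * y₀) + b * (c * x₀ * y₁ + c * x₁ * y₀) + C * (c * x₁ * y₁) + c * i ≡
    c * (A * (x₀ * y₀) + b * (x₀ * y₁ + x₁ * y₀) + C * (x₁ * y₁) + i)
  identity = solve-∀

gramForm-zeroˡ : ∀ {t} (gs : Vector Gram t) {x} y → (∀ j → x j ≡ 0ℤ) → gramForm gs x y ≡ 0ℤ
gramForm-zeroˡ gs y x≈0 = trans (gramForm-cong gs x≈0 (λ _ → refl)) (gramForm-*ˡ gs 0ℤ (λ _ → 0ℤ) y)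

NormsIn : (ℤ → Set) → Gram → Set
NormsIn P g = ∀ x y → ¬ (x ≡ 0ℤ × y ≡ 0ℤ) → P (norm g x y)

-- A norm in an orthogonal sum is the sum of the norms of the components; the nonzero components
-- contribute elements of `P`, the others 0. With `0ℤ <_` this gives positivity, with `Good` it
-- restricts the represented numbers.
gramForm-norms : ∀ {P} → (∀ {i j} → P i → P j → P (i + j)) →
  ∀ {t} (gs : Vector Gram t) → (∀ i → NormsIn P (gs i)) →
  ∀ x → (∀ j → x j ≡ 0ℤ) ⊎ P (gramForm gs x x)
gramForm-norms P-+ {zero} gs gs∈P x = inj₁ λ ()
gramForm-norms {P} P-+ {suc t} gs gs∈P x
  with x zero ℤ.≟ 0ℤ ×-dec x (suc zero) ℤ.≟ 0ℤ
     | gramForm-norms {P} P-+ (tail gs) (λ i → gs∈P (suc i)) (tail (tail x))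
... | yes (x₀≡0 , x₁≡0) | inj₁ rest≡0 =
  inj₁ λ { zero → x₀≡0 ; (suc zero) → x₁≡0 ; (suc (suc j)) → rest≡0 j }
... | yes (x₀≡0 , x₁≡0) | inj₂ rest∈P = inj₂ (subst P (sym (trans
  (cong (_+ gramForm (tail gs) (tail (tail x)) (tail (tail x)))
    (trans (form-cong (gs zero) x₀≡0 x₁≡0 x₀≡0 x₁≡0) (form-zero (gs zero))))
  (ℤ.+-identityˡ _))) rest∈P)
... | no x₀x₁≢0 | inj₁ rest≡0 = inj₂ (subst P (sym (trans
  (cong (λ i → norm (gs zero) (x zero) (x (suc zero)) + i) (gramForm-zeroˡ (tail gs) _ rest≡0))
  (ℤ.+-identityʳ _))) (gs∈P zero (x zero) (x (suc zero)) x₀x₁≢0))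
... | no x₀x₁≢0 | inj₂ rest∈P = inj₂ (P-+ (gs∈P zero (x zero) (x (suc zero)) x₀x₁≢0) rest∈P)

orthogonalSum : ∀ {t} (gs : Vector Gram t) → (∀ i → NormsIn (0ℤ <_) (gs i)) → ℤ-Lattice
orthogonalSum {t} gs positive = record
  { leftModule = ℤ^ (t ℕ.* 2)
  ; rank       = t ℕ.* 2
  ; basis      = standardBasis
  ; isBasis    = standardBasis-isBasis
  ; B          = gramForm gs
  ; B-cong     = gramForm-cong gs
  ; B-sym      = gramForm-sym gs
  ; B-+ˡ       = gramForm-+ˡ gs
  ; B-*ˡ       = gramForm-*ˡ gs
  ; B-positive = B-positive
  }
  where
  B-positive : ∀ x → ¬ (∀ j → x j ≡ 0ℤ) → 0ℤ < gramForm gs x x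
  B-positive x x≢0 with gramForm-norms {0ℤ <_} ℤ.+-mono-< gs positive x
  ... | inj₁ x≡0   = contradiction x≡0 x≢0
  ... | inj₂ 0<Bxx = 0<Bxx

inject : ∀ {t} → Fin t → ℤ → ℤ → Vector ℤ (t ℕ.* 2)
inject zero    x y = x ∷ y ∷ λ _ → 0ℤ
inject (suc i) x y = 0ℤ ∷ 0ℤ ∷ inject i x y

gramForm-inject : ∀ {t} (gs : Vector Gram t) i x y x′ y′ →
  gramForm gs (inject i x y) (inject i x′ y′) ≡ form (gs i) x y x′ y′
gramForm-inject {suc t} gs zero x y x′ y′ = trans
  (cong (λ i → form (gs zero) x y x′ y′ + i) (gramForm-zeroˡ (tail gs) _ (λ _ → refl)))
  (ℤ.+-identityʳ _)
gramForm-inject {suc t} gs (suc i) x y x′ y′ = trans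
  (cong (_+ gramForm (tail gs) (inject i x y) (inject i x′ y′)) (form-zero (gs zero)))
  (trans (ℤ.+-identityˡ _) (gramForm-inject (tail gs) i x y x′ y′))

inject-linear : ∀ {M : LeftModule ℤ.+-*-ring 0ℓ 0ℓ} {t} (i : Fin t) {f g} →
  IsLinear M f → IsLinear M g → ∀ j → IsLinear M (λ w → inject i (f w) (g w) j)
inject-linear zero    lf lg zero          = lf
inject-linear zero    lf lg (suc zero)    = lg
inject-linear zero    lf lg (suc (suc j)) = zero-linear
inject-linear (suc i) lf lg zero          = zero-linear
inject-linear (suc i) lf lg (suc zero)    = zero-linear
inject-linear (suc i) lf lg (suc (suc j)) = inject-linear i lf lg j

-- Good numbers and binary forms with good norms.

module GoodNorms (m : ℕ) (2≤m : 2 ℕ.≤ m) (4∤m : ¬ 4 ℕ.∣ m) where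

  private
    M : ℤ
    M = + m

    0≤M-2 : 0ℤ ≤ M - + 2
    0≤M-2 = ℤ.i≤j⇒0≤j-i (+≤+ 2≤m)

    0≤M-1 : 0ℤ ≤ M - 1ℤ
    0≤M-1 = ℤ.i≤j⇒0≤j-i (+≤+ (ℕ.<⇒≤ 2≤m))

    -- The expression equals 4(m - 1) - m, the least amount by which (m - 1)y² exceeds m when ∣y∣ ≥
    -- 2.
    0<3M-4 : 0ℤ < + 3 * (M - + 2) + + 2
    0<3M-4 = ℤ.+-mono-≤-< (0≤* {+ 3} (+≤+ z≤n) 0≤M-2) (+<+ (s≤s z≤n))

    M≡M-1+1 : ∀ M → M ≡ M - 1ℤ + 1ℤ
    M≡M-1+1 = solve-∀

    0<M : 0ℤ < M
    0<M = +<+ (ℕ.<⇒≤ 2≤m)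

  -- The guard `2 ℕ.< m` keeps 1 from being good: for m = 2 the number m - 1 is 1.
  Good : ℤ → Set
  Good N = (0ℤ < N × + 4 ∣ N) ⊎ (M < N) ⊎ (N ≡ M - 1ℤ × 2 ℕ.< m)

  Good⇒0< : ∀ {N} → Good N → 0ℤ < N
  Good⇒0< (inj₁ (0<N , _))          = 0<N
  Good⇒0< (inj₂ (inj₁ M<N))         = ℤ.<-trans 0<M M<N
  Good⇒0< (inj₂ (inj₂ (refl , 2<m))) =
    ℤ.<-≤-trans (+<+ (s≤s z≤n)) (ℤ.+-monoˡ-≤ (- 1ℤ) (+≤+ 2≤m))

  1-notGood : ¬ Good 1ℤ
  1-notGood (inj₁ (_ , 4∣1)) = from-no (4 ℕ.∣? 1) (∣⇒∣ᵤ 4∣1)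
  1-notGood (inj₂ (inj₁ M<1)) = ℤ.<⇒≱ M<1 (+≤+ (ℕ.<⇒≤ 2≤m))
  1-notGood (inj₂ (inj₂ (1≡M-1 , 2<m))) =
    ℕ.<-irrefl (ℤ.+-injective (trans (cong (_+ 1ℤ) 1≡M-1) (sym (M≡M-1+1 M)))) 2<m

  m-notGood : ¬ Good M
  m-notGood (inj₁ (_ , 4∣M)) = 4∤m (∣⇒∣ᵤ 4∣M)
  m-notGood (inj₂ (inj₁ M<M)) = ℤ.<-irrefl refl M<M
  m-notGood (inj₂ (inj₂ (M≡M-1 , _))) =
    ℤ.<-irrefl (sym M≡M-1) (<-offset 1ℤ (M≡M-1+1 M) (+<+ (s≤s z≤n)))

  private
    1<multipleOf4 : ∀ {N} → 0ℤ < N → + 4 ∣ N → 1ℤ < N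
    1<multipleOf4 {+[1+ 0 ]}     _ 4∣1 = contradiction (∣⇒∣ᵤ 4∣1) (from-no (4 ℕ.∣? 1))
    1<multipleOf4 {+[1+ suc _ ]} _ _   = +<+ (s≤s (s≤s z≤n))
    1<multipleOf4 { -[1+ _ ]} () _
    1<multipleOf4 {+0} (+<+ ()) _

    M<M-1+ : ∀ {N} → 1ℤ < N → M < M - 1ℤ + N
    M<M-1+ {N} 1<N = subst (_< M - 1ℤ + N) (sym (M≡M-1+1 M)) (ℤ.+-monoʳ-< (M - 1ℤ) 1<N)

    M<+ˡ : ∀ {N N′} → M < N → Good N′ → M < N + N′
    M<+ˡ {N} {N′} M<N gN′ =
      subst (_< N + N′) (ℤ.+-identityʳ M) (ℤ.+-mono-< M<N (Good⇒0< gN′))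

  -- Multiples of 4 add up to a multiple of 4, and a summand above m keeps the sum above m. In the
  -- remaining cases one summand is m - 1 and the other is at least 2, being a positive multiple of
  -- 4 or again m - 1 with m > 2; the sum then exceeds m.
  Good-+ : ∀ {N N′} → Good N → Good N′ → Good (N + N′)
  Good-+ (inj₁ (0<N , 4∣N)) (inj₁ (0<N′ , 4∣N′)) =
    inj₁ (ℤ.+-mono-< 0<N 0<N′ , ∣m∣n⇒∣m+n 4∣N 4∣N′)
  Good-+ (inj₂ (inj₁ M<N)) gN′ = inj₂ (inj₁ (M<+ˡ M<N gN′))
  Good-+ {N} {N′} gN (inj₂ (inj₁ M<N′)) =
    inj₂ (inj₁ (subst (M <_) (ℤ.+-comm N′ N) (M<+ˡ M<N′ gN)))
  Good-+ (inj₂ (inj₂ (refl , _))) (inj₁ (0<N′ , 4∣N′)) =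
    inj₂ (inj₁ (M<M-1+ (1<multipleOf4 0<N′ 4∣N′)))
  Good-+ {N} {N′} (inj₁ (0<N , 4∣N)) (inj₂ (inj₂ (refl , _))) =
    inj₂ (inj₁ (subst (M <_) (ℤ.+-comm N′ N) (M<M-1+ (1<multipleOf4 0<N 4∣N))))
  Good-+ (inj₂ (inj₂ (refl , 2<m))) (inj₂ (inj₂ (refl , _))) =
    inj₂ (inj₁ (M<M-1+ (ℤ.+-monoˡ-< (- 1ℤ) (+<+ 2<m))))

  GoodForm : Gram → Set
  GoodForm = NormsIn Good

  private
    scaled-norm : ∀ c x y → norm (gram c 0ℤ c) x y ≡ c * (x * x + y * y)
    scaled-norm = identity
      where
      identity : ∀ c x y →
        c * (x * x) + 0ℤ * (x * y + y * x) + c * (y * y) ≡ c * (x * x + y * y)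
      identity = solve-∀

  scaled-good-∣ : ∀ {c} → 0ℤ < c → + 4 ∣ c → GoodForm (gram c 0ℤ c)
  scaled-good-∣ {c} 0<c 4∣c x y xy≢0 = subst Good (sym (scaled-norm c x y))
    (inj₁ (0<* 0<c (0<sumOfSquares x y xy≢0) , ∣m⇒∣m*n (x * x + y * y) 4∣c))

  scaled-good-< : ∀ {c} → M < c → GoodForm (gram c 0ℤ c)
  scaled-good-< {c} M<c x y xy≢0 = subst Good (sym (scaled-norm c x y)) (inj₂ (inj₁
    (ℤ.<-≤-trans M<c (subst (_≤ c * (x * x + y * y)) (ℤ.*-identityʳ c)
      (ℤ.*-monoˡ-≤-nonNeg c {{nonNegative (ℤ.<⇒≤ (ℤ.<-trans 0<M M<c))}}
        (ℤ.i<j⇒suc[i]≤j (0<sumOfSquares x y xy≢0)))))))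

  private
    axis-norm : ∀ A b C x → norm (gram A b C) x 0ℤ ≡ A * (x * x)
    axis-norm = identity
      where
      identity : ∀ A b C x →
        A * (x * x) + b * (x * 0ℤ + 0ℤ * x) + C * (0ℤ * 0ℤ) ≡ A * (x * x)
      identity = solve-∀

    axis-good : ∀ {A} b C {x} → 0ℤ < A → + 4 ∣ A → ¬ x ≡ 0ℤ →
      Good (norm (gram A b C) x 0ℤ)
    axis-good {A} b C {x} 0<A 4∣A x≢0 = subst Good (sym (axis-norm A b C x))
      (inj₁ (0<* 0<A (square-positive x x≢0) , ∣m⇒∣m*n (x * x) 4∣A))

  -- The norm is n²x² + my² − (x + y)².
  unshiftedForm : ℕ → Gram
  unshiftedForm n = gram (+ n * + n - 1ℤ) (- 1ℤ) (M - 1ℤ)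

  -- On the axis y = 0 the norms are multiples of n² - 1, hence of 4. On the axis x = 0 they are (m
  -- - 1)y², which is m - 1 for y = ±1 and exceeds m otherwise. Off the axes they exceed m.
  unshifted-good : ∀ {n} → 3 ℕ.≤ n → 2 ℕ.< m → + 4 ∣ + n * + n - 1ℤ → GoodForm (unshiftedForm n)
  unshifted-good {n} 3≤n 2<m 4∣n²-1 x y xy≢0 with y ℤ.≟ 0ℤ | x ℤ.≟ 0ℤ
  ... | yes refl | _ = axis-good (- 1ℤ) (M - 1ℤ) 0<n²-1 4∣n²-1 (λ x≡0 → xy≢0 (x≡0 , refl))
    where
    0<n²-1 : 0ℤ < + n * + n - 1ℤ
    0<n²-1 = ℤ.+-monoˡ-< (- 1ℤ) (ℤ.<-≤-trans {1ℤ} {+ 9} (+<+ (s≤s (s≤s z≤n)))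
      (∣∣≤⇒square≤ (+ 3) (+ n) 3≤n))
  ... | no y≢0 | yes refl with square≡1⊎2≤∣∣ y y≢0
  ...   | inj₁ y²≡1 = inj₂ (inj₂ (trans
            (cong (λ s → (+ n * + n - 1ℤ) * 0ℤ + - 1ℤ * (0ℤ * y + y * 0ℤ) + (M - 1ℤ) * s) y²≡1)
            (identity (+ n * + n - 1ℤ) M y) , 2<m))
    where
    identity : ∀ A M y → A * 0ℤ + - 1ℤ * (0ℤ * y + y * 0ℤ) + (M - 1ℤ) * 1ℤ ≡ M - 1ℤ
    identity = solve-∀
  ...   | inj₂ 2≤∣y∣ = inj₂ (inj₁ (<-offset _ (identity (+ n * + n - 1ℤ) M y)
            (ℤ.+-mono-≤-< (0≤* 0≤M-1 (0≤square-4 {y} 2≤∣y∣)) 0<3M-4)))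
    where
    identity : ∀ A M y → A * 0ℤ + - 1ℤ * (0ℤ * y + y * 0ℤ) + (M - 1ℤ) * (y * y) ≡
      M + ((M - 1ℤ) * (y * y - + 4) + (+ 3 * (M - + 2) + + 2))
    identity = solve-∀
  unshifted-good {n} 3≤n 2<m 4∣n²-1 x y xy≢0 | no y≢0 | no x≢0 =
    -- Completing the square turns the norm into (n² - 2)x² + (m - 2)y² + (x - y)². With n² ≥ 9 and
    -- x², y² ≥ 1 this is at least m + 5.
    inj₂ (inj₁ (<-offset _ (identity (+ n) M x y)
      (ℤ.+-mono-≤-< (ℤ.+-mono-≤ (ℤ.+-mono-≤ (ℤ.+-mono-≤
        (0≤* 0≤n²-9 (square-nonNegative x))
        (0≤* {+ 7} (+≤+ z≤n) (0≤square-1 x≢0)))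
        (0≤* 0≤M-2 (0≤square-1 y≢0)))
        (square-nonNegative (x - y)))
        (+<+ {0} {5} (s≤s z≤n)))))
    where
    0≤n²-9 : 0ℤ ≤ + n * + n - + 9
    0≤n²-9 = ℤ.i≤j⇒0≤j-i (∣∣≤⇒square≤ (+ 3) (+ n) 3≤n)
    identity : ∀ n M x y →
      (n * n - 1ℤ) * (x * x) + - 1ℤ * (x * y + y * x) + (M - 1ℤ) * (y * y) ≡
      M + ((n * n - + 9) * (x * x) + + 7 * (x * x - 1ℤ) + (M - + 2) * (y * y - 1ℤ)
           + (x - y) * (x - y) + + 5)
    identity = solve-∀

  -- The norm is (nx + ky)² + my² − εx²; with ε the parity of n, 4 divides n² − ε.
  shiftedForm : ℕ → ℕ → ℤ → Gram
  shiftedForm ε n k = gram (+ n * + n - + ε) (+ n * k) (k * k + M)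

  module _ {ε n k} (ε≤1 : ε ℕ.≤ 1) (k≢0 : ¬ k ≡ 0ℤ) (∣k∣<n-ε : ∣ k ∣ ℕ.+ suc ε ℕ.≤ n) where
    private
      shifted-norm : ∀ n k e M x y →
        (n * n - e) * (x * x) + n * k * (x * y + y * x) + (k * k + M) * (y * y) ≡
        (n * x + k * y) * (n * x + k * y) + M * (y * y) - e * (x * x)
      shifted-norm = solve-∀

      0<n²-ε : 0ℤ < + n * + n - + ε
      0<n²-ε = ℤ.<-≤-trans {0ℤ} {+ 4 - + ε} (lemma ε≤1)
        (ℤ.+-monoˡ-≤ (- + ε) (∣∣≤⇒square≤ (+ 2) (+ n) 2≤n))
        where
        lemma : ∀ {ε} → ε ℕ.≤ 1 → 0ℤ < + 4 - + ε
        lemma z≤n = +<+ (s≤s z≤n)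
        lemma (s≤s z≤n) = +<+ (s≤s z≤n)
        2≤n : 2 ℕ.≤ n
        2≤n = ℕ.≤-trans (ℕ.+-mono-≤ (ℕ.n≢0⇒n>0 (λ ∣k∣≡0 → k≢0 (ℤ.∣i∣≡0⇒i≡0 ∣k∣≡0))) (s≤s z≤n)) ∣k∣<n-ε

      -- With X = nx + ky, the triangle inequality gives n∣x∣ ≤ ∣X∣ + ∣k∣∣y∣ ≤ ∣X∣ + ∣k∣∣x∣, while n
      -- ≥ ∣k∣ + 1 + ε. The factor 1 + ε lets X² outweigh the subtracted term εx².
      X-dominates : ∀ x y → ∣ y ∣ ℕ.≤ ∣ x ∣ → ∣ + suc ε * x ∣ ℕ.≤ ∣ + n * x + k * y ∣
      X-dominates x y ∣y∣≤∣x∣ = ℕ.+-cancelˡ-≤ (∣ k ∣ ℕ.* ∣ x ∣) _ _ (begin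
        ∣ k ∣ ℕ.* ∣ x ∣ ℕ.+ ∣ + suc ε * x ∣ ≡⟨ cong (∣ k ∣ ℕ.* ∣ x ∣ ℕ.+_) (ℤ.abs-* (+ suc ε) x) ⟩
        ∣ k ∣ ℕ.* ∣ x ∣ ℕ.+ suc ε ℕ.* ∣ x ∣ ≡⟨ ℕ.*-distribʳ-+ ∣ x ∣ ∣ k ∣ (suc ε) ⟨
        (∣ k ∣ ℕ.+ suc ε) ℕ.* ∣ x ∣         ≤⟨ ℕ.*-monoˡ-≤ ∣ x ∣ ∣k∣<n-ε ⟩
        n ℕ.* ∣ x ∣                         ≡⟨ ℤ.abs-* (+ n) x ⟨
        ∣ + n * x ∣                         ≡⟨ cong ∣_∣ (identity (+ n * x) (k * y)) ⟩
        ∣ - (k * y) + X ∣                   ≤⟨ ℤ.∣i+j∣≤∣i∣+∣j∣ (- (k * y)) X ⟩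
        ∣ - (k * y) ∣ ℕ.+ ∣ X ∣             ≡⟨ cong (ℕ._+ ∣ X ∣) (trans (ℤ.∣-i∣≡∣i∣ (k * y)) (ℤ.abs-* k y)) ⟩
        ∣ k ∣ ℕ.* ∣ y ∣ ℕ.+ ∣ X ∣           ≤⟨ ℕ.+-monoˡ-≤ ∣ X ∣ (ℕ.*-monoʳ-≤ ∣ k ∣ ∣y∣≤∣x∣) ⟩
        ∣ k ∣ ℕ.* ∣ x ∣ ℕ.+ ∣ X ∣           ∎)
        where
        open ℕ.≤-Reasoning
        X = + n * x + k * y
        identity : ∀ i j → i ≡ - j + (i + j)
        identity = solve-∀

      -- For x = 0 the term k²y² is a positive surplus over my² ≥ m. For 0 < ∣x∣ with ∣y∣ ≤ ∣x∣,
      -- `X-dominates` makes X² - εx² positive. For 0 < ∣x∣ < ∣y∣ the subtracted term is at most y²,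
      -- and (m - 1)y² ≥ 4(m - 1) > m.
      off-axis : ∀ x y → ¬ y ≡ 0ℤ →
        M < (+ n * x + k * y) * (+ n * x + k * y) + M * (y * y) - + ε * (x * x)
      off-axis x y y≢0 with x ℤ.≟ 0ℤ | ∣ y ∣ ℕ.≤? ∣ x ∣
      ... | yes refl | _ = <-offset _ (identity (+ n) k (+ ε) M y)
        (ℤ.+-mono-<-≤ (0<* (square-positive k k≢0) (square-positive y y≢0))
          (0≤* (ℤ.<⇒≤ 0<M) (0≤square-1 y≢0)))
        where
        identity : ∀ n k e M y →
          (n * 0ℤ + k * y) * (n * 0ℤ + k * y) + M * (y * y) - e * 0ℤ ≡
          M + (k * k * (y * y) + M * (y * y - 1ℤ))
        identity = solve-∀
      ... | no x≢0 | yes ∣y∣≤∣x∣ = <-offset _ (identity (+ n * x + k * y) (+ ε) M x y)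
        (ℤ.+-mono-≤-< (ℤ.+-mono-≤ (ℤ.+-mono-≤
          (0≤* (ℤ.<⇒≤ 0<M) (0≤square-1 y≢0))
          (ℤ.i≤j⇒0≤j-i (∣∣≤⇒square≤ (+ suc ε * x) (+ n * x + k * y) (X-dominates x y ∣y∣≤∣x∣))))
          (0≤* (ℤ.+-mono-≤ (+≤+ (z≤n {ε})) (square-nonNegative (+ ε))) (square-nonNegative x)))
          (square-positive x x≢0))
        where
        identity : ∀ X e M x y →
          X * X + M * (y * y) - e * (x * x) ≡
          M + (M * (y * y - 1ℤ) + (X * X - (1ℤ + e) * x * ((1ℤ + e) * x))
               + (e + e * e) * (x * x) + x * x)
        identity = solve-∀
      ... | no x≢0 | no ∣y∣≰∣x∣ = <-offset _ (identity (+ n * x + k * y) (+ ε) M x y)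
        (ℤ.+-mono-≤-< (ℤ.+-mono-≤ (ℤ.+-mono-≤ (ℤ.+-mono-≤
          (square-nonNegative (+ n * x + k * y))
          (ℤ.i≤j⇒0≤j-i (∣∣≤⇒square≤ x y (ℕ.<⇒≤ ∣x∣<∣y∣))))
          (0≤* (ℤ.i≤j⇒0≤j-i (+≤+ ε≤1)) (square-nonNegative x)))
          (0≤* 0≤M-1 (0≤square-4 {y} 2≤∣y∣)))
          0<3M-4)
        where
        ∣x∣<∣y∣ : ∣ x ∣ ℕ.< ∣ y ∣
        ∣x∣<∣y∣ = ℕ.≰⇒> ∣y∣≰∣x∣
        2≤∣y∣ : 2 ℕ.≤ ∣ y ∣
        2≤∣y∣ = ℕ.≤-trans (s≤s (ℕ.n≢0⇒n>0 (λ ∣x∣≡0 → x≢0 (ℤ.∣i∣≡0⇒i≡0 ∣x∣≡0)))) ∣x∣<∣y∣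
        identity : ∀ X e M x y →
          X * X + M * (y * y) - e * (x * x) ≡
          M + (X * X + (y * y - x * x) + (1ℤ - e) * (x * x) + (M - 1ℤ) * (y * y - + 4)
               + (+ 3 * (M - + 2) + + 2))
        identity = solve-∀

    shifted-good : + 4 ∣ + n * + n - + ε → GoodForm (shiftedForm ε n k)
    shifted-good 4∣n²-ε x y xy≢0 with y ℤ.≟ 0ℤ
    ... | yes refl = axis-good (+ n * k) (k * k + M) 0<n²-ε 4∣n²-ε (λ x≡0 → xy≢0 (x≡0 , refl))
    ... | no y≢0 = subst Good (sym (shifted-norm (+ n) k (+ ε) M x y)) (inj₂ (inj₁ (off-axis x y y≢0)))

-- Congruences on the coordinates of a proper sublattice.

open RawMonad (¬¬-Monad {0ℓ}) using (_>>=_; rawApplicative)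

-- Collects the classical choices made separately for each of finitely many sublattices.
¬¬-Π : ∀ {t} {P : Fin t → Set} → (∀ i → ¬ ¬ P i) → ¬ ¬ (∀ i → P i)
¬¬-Π = sequence rawApplicative

-- If the least positive element n of H did not divide h ∈ H, the remainder
-- of h modulo n would be a smaller one.
properSubgroup⊆multiples : (H : ℤ → Set) → (∀ {i j} → H i → H j → ∀ c → H (i - c * j)) →
  ¬ H 1ℤ → ¬ ¬ (∃[ n ] 2 ℕ.≤ n × (∀ {i} → H i → + n ∣ i))
-- Under `none`, `absent⁺` leaves `H` without positive elements. As `H` is closed under negation it
-- is zero, so the default modulus 2 divides all of it.
properSubgroup⊆multiples H H-sub 1∉H none = none (2 , ℕ.≤-refl , λ {i} → 2∣ i)
  where
  absent⁺ : ∀ n → ¬ H +[1+ n ]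
  absent⁺ = <-rec _ step
    where
    step : ∀ n → (∀ {k} → k ℕ.< n → ¬ H +[1+ k ]) → ¬ H +[1+ n ]
    step zero    _  1∈H = 1∉H 1∈H
    step n@(suc _) ih n∈H = none (suc n , s≤s (s≤s z≤n) , n∣)
      where
      n∣ : ∀ {i} → H i → + suc n ∣ i
      n∣ {i} i∈H with i %ℕ suc n | n%ℕd<d i (suc n) | a≡a%ℕn+[a/ℕn]*n i (suc n)
      ... | zero  | _       | i≡ = divides (i /ℕ suc n) (trans i≡ (ℤ.+-identityˡ _))
      ... | suc r | s≤s r<n | i≡ = contradiction
        (subst H (trans (cong (_- i /ℕ suc n * + suc n) i≡) (cancel +[1+ r ] (i /ℕ suc n * + suc n)))
          (H-sub i∈H n∈H (i /ℕ suc n)))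
        (ih r<n)
        where
        cancel : ∀ i j → i + j - j ≡ i
        cancel = solve-∀

  2∣ : ∀ i → H i → + 2 ∣ i
  2∣ +0       _   = divides 0ℤ refl
  2∣ +[1+ n ] i∈H = contradiction i∈H (absent⁺ n)
  2∣ -[1+ n ] i∈H = contradiction (subst H (reflect -[1+ n ]) (H-sub i∈H i∈H (+ 2))) (absent⁺ n)
    where
    reflect : ∀ i → i - + 2 * i ≡ - i
    reflect = solve-∀

-- The quotient `q` is carried as a linear functional because it later serves as a coordinate of the
-- embedding.
data Congruence (M : LeftModule ℤ.+-*-ring 0ℓ 0ℓ) (X Y : LeftModule.Carrierᴹ M → ℤ) : Set where
  Y-multiple : ∀ n → 2 ℕ.≤ n → ∀ q → IsLinear M q → (∀ w → Y w ≡ q w * + n) → Congruence M X Y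
  X-residue  : ∀ n → 2 ℕ.≤ n → ∀ k q → IsLinear M q → (∀ w → X w ≡ q w * + n + k * Y w) →
               Congruence M X Y

module _ {M : LeftModule ℤ.+-*-ring 0ℓ 0ℓ} {X Y : LeftModule.Carrierᴹ M → ℤ}
  (lX : IsLinear M X) (lY : IsLinear M Y)
  where
  open LeftModule M
  private
    sub-homo : ∀ {f} → IsLinear M f → ∀ u w c → f (u +ᴹ (- c) *ₗ w) ≡ f u - c * f w
    sub-homo {f} lf u w c = trans (F.+-homo u ((- c) *ₗ w))
      (cong (λ i → f u + i) (trans (F.*-homo (- c) w) (sym (ℤ.neg-distribˡ-* c (f w)))))
      where module F = IsLinear lf

    combination-homo : ∀ {f} → IsLinear M f → ∀ a b u w → f (a *ₗ u +ᴹ b *ₗ w) ≡ a * f u + b * f w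
    combination-homo lf a b u w =
      trans (F.+-homo (a *ₗ u) (b *ₗ w)) (cong₂ _+_ (F.*-homo a u) (F.*-homo b w))
      where module F = IsLinear lf

    YValue : ℤ → Set
    YValue i = ∃[ w ] Y w ≡ i

    XValue : ℤ → Set
    XValue i = ∃[ w ] X w ≡ i × Y w ≡ 0ℤ

    YValue-sub : ∀ {i j} → YValue i → YValue j → ∀ c → YValue (i - c * j)
    YValue-sub (u , refl) (w , refl) c = u +ᴹ (- c) *ₗ w , sub-homo lY u w c

    XValue-sub : ∀ {i j} → XValue i → XValue j → ∀ c → XValue (i - c * j)
    XValue-sub (u , refl , Yu≡0) (w , refl , Yw≡0) c = u +ᴹ (- c) *ₗ w , sub-homo lX u w c ,
      trans (sub-homo lY u w c) (trans (cong₂ (λ i j → i - c * j) Yu≡0 Yw≡0) (identity c))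
      where
      identity : ∀ c → 0ℤ - c * 0ℤ ≡ 0ℤ
      identity = solve-∀

  -- If 1 is not a value of `Y`, the values of `Y` form a proper subgroup of ℤ. Otherwise choose `v`
  -- with `Y v ≡ 1`. The values of `X` on the kernel of `Y` omit 1, since a vector `u` there with
  -- `X u ≡ 1` would, with `v`, reach every (x , y). So they are multiples of some n ≥ 2, and moving
  -- `w` into the kernel by subtracting `Y w` times `v` gives X w ≡ (X v)(Y w) modulo n.
  proper⇒congruence : ¬ (∀ x y → ∃[ w ] X w ≡ x × Y w ≡ y) → ¬ ¬ Congruence M X Y
  proper⇒congruence proper = ¬¬-excluded-middle >>= λ where
      (no 1∉Y) → ¬¬-map Y-case (properSubgroup⊆multiples YValue YValue-sub 1∉Y)
      (yes (v , Yv≡1)) → ¬¬-map (X-case v Yv≡1)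
        (properSubgroup⊆multiples XValue XValue-sub λ 1∈X → proper (surjective v Yv≡1 1∈X))
    where
    Y-case : (∃[ n ] 2 ℕ.≤ n × (∀ {i} → YValue i → + n ∣ i)) → Congruence M X Y
    Y-case (n@(suc _) , 2≤n , n∣) =
      Y-multiple n 2≤n (λ w → quotient (n∣ (w , refl))) (quotient-linear n lY Y≡qn) Y≡qn
      where
      Y≡qn : ∀ w → Y w ≡ quotient (n∣ (w , refl)) * + n
      Y≡qn w = _∣_.equality (n∣ (w , refl))

    X-case : ∀ v → Y v ≡ 1ℤ → (∃[ n ] 2 ℕ.≤ n × (∀ {i} → XValue i → + n ∣ i)) → Congruence M X Y
    X-case v Yv≡1 (n@(suc _) , 2≤n , n∣) =
      X-residue n 2≤n (X v) q
        (quotient-linear n (+-linear lX (scale-linear (- X v) lY))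
          (λ w → trans (flip (X w) (Y w) (X v)) (_∣_.equality (n∣ (value w)))))
        (λ w → trans (split (X w) (Y w) (X v)) (cong (_+ X v * Y w) (_∣_.equality (n∣ (value w)))))
      where
      flip : ∀ x y k → x + - k * y ≡ x - y * k
      flip = solve-∀
      split : ∀ x y k → x ≡ x - y * k + k * y
      split = solve-∀
      cancel : ∀ y → y - y * 1ℤ ≡ 0ℤ
      cancel = solve-∀
      value : ∀ w → XValue (X w - Y w * X v)
      value w = w +ᴹ (- Y w) *ₗ v , sub-homo lX w v (Y w) ,
        trans (sub-homo lY w v (Y w)) (trans (cong (λ i → Y w - Y w * i) Yv≡1) (cancel (Y w)))
      q : Carrierᴹ → ℤ
      q w = quotient (n∣ (value w))

    surjective : ∀ v → Y v ≡ 1ℤ → XValue 1ℤ → ∀ x y → ∃[ w ] X w ≡ x × Y w ≡ y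
    surjective v Yv≡1 (u , Xu≡1 , Yu≡0) x y = (x - y * X v) *ₗ u +ᴹ y *ₗ v ,
      trans (combination-homo lX _ y u v)
        (trans (cong (λ i → (x - y * X v) * i + y * X v) Xu≡1) (X-identity x y (X v))) ,
      trans (combination-homo lY _ y u v)
        (trans (cong₂ (λ i j → (x - y * X v) * i + y * j) Yu≡0 Yv≡1) (Y-identity x y (X v)))
      where
      X-identity : ∀ x y k → (x - y * k) * 1ℤ + y * k ≡ x
      X-identity = solve-∀
      Y-identity : ∀ x y k → (x - y * k) * 0ℤ + y * 1ℤ ≡ y
      Y-identity = solve-∀

-- Embeddings into ⟨1, m - 1⟩ ⊥ p.

baseForm : ℤ → Gram
baseForm M = gram 1ℤ 0ℤ (M - 1ℤ)

-- K ↪ ⟨1, M − 1⟩ ⊥ p, with coordinates a, c in ⟨1, M − 1⟩ and x, y in p.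
record Fits (M : ℤ) (K : ℤ-Lattice) (p : Gram) : Set where
  open ℤ-Lattice K using (leftModule; Carrierᴹ; B)
  field
    {a c x y} : Carrierᴹ → ℤ
    a-linear  : IsLinear leftModule a
    c-linear  : IsLinear leftModule c
    x-linear  : IsLinear leftModule x
    y-linear  : IsLinear leftModule y
    isometric : ∀ u w → B u w ≡
      form (baseForm M) (a u) (c u) (a w) (c w) + form p (x u) (y u) (x w) (y w)

module _ (m : ℕ) (2≤m : 2 ℕ.≤ m) (4∤m : ¬ 4 ℕ.∣ m) where
  open GoodNorms m 2≤m 4∤m

  private
    M : ℤ
    M = + m

  module _ (K : ℤ-Lattice) {X Y : ℤ-Lattice.Carrierᴹ K → ℤ}
    (lX : IsLinear (ℤ-Lattice.leftModule K) X) (lY : IsLinear (ℤ-Lattice.leftModule K) Y)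
    (isometry : ∀ u w → ℤ-Lattice.B K u w ≡ X u * X w + + m * (Y u * Y w))
    where
    open ℤ-Lattice K using (leftModule; Carrierᴹ; B)

    private
      substituted : ∀ {X′ Y′ : Carrierᴹ → ℤ} → (∀ w → X w ≡ X′ w) → (∀ w → Y w ≡ Y′ w) →
        ∀ u w → B u w ≡ X′ u * X′ w + M * (Y′ u * Y′ w)
      substituted X≡ Y≡ u w = trans (isometry u w)
        (cong₂ (λ i j → i + M * j) (cong₂ _*_ (X≡ u) (X≡ w)) (cong₂ _*_ (Y≡ u) (Y≡ w)))

      odd≥3 : ∀ n h → 2 ℕ.≤ n → n ≡ 1 ℕ.+ h ℕ.* 2 → 3 ℕ.≤ n
      odd≥3 _ zero    (s≤s ()) refl
      odd≥3 _ (suc h) _        refl = s≤s (s≤s (s≤s z≤n))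

    -- Since mY² = Y² + (m - 1)Y², the diagonal Y ↦ (Y , Y) embeds ⟨m⟩ in ⟨1, m - 1⟩; only X = nq,
    -- of norm n²q², is left for `p`.
    zeroResidueFits : ∀ n {q} → IsLinear leftModule q → (∀ w → X w ≡ q w * + n + 0ℤ * Y w) →
      GoodForm (gram (+ n * + n) 0ℤ (+ n * + n)) → ∃[ p ] GoodForm p × Fits M K p
    zeroResidueFits n {q} lq X≡ good = gram (+ n * + n) 0ℤ (+ n * + n) , good , record
      { a-linear = lY ; c-linear = lY ; x-linear = lq ; y-linear = zero-linear
      ; isometric = λ u w → trans (substituted X≡ (λ _ → refl) u w)
          (identity M (+ n) (q u) (q w) (Y u) (Y w))
      }
      where
      identity : ∀ M n q q′ Y Y′ → (q * n + 0ℤ * Y) * (q′ * n + 0ℤ * Y′) + M * (Y * Y′) ≡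
        1ℤ * (Y * Y′) + 0ℤ * (Y * Y′ + Y * Y′) + (M - 1ℤ) * (Y * Y′) +
        (n * n * (q * q′) + 0ℤ * (q * 0ℤ + 0ℤ * q′) + n * n * (0ℤ * 0ℤ))
      identity = solve-∀

    -- The coordinate of norm 1 is set to εq. It absorbs ε²q² = εq², and the rest of the norm is
    -- `shiftedForm` at (q , Y).
    nonzeroResidueFits : ∀ n ε h k → ε ℕ.≤ 1 → n ≡ ε ℕ.+ h ℕ.* 2 → ¬ k ≡ 0ℤ →
      ∣ k ∣ ℕ.+ suc ε ℕ.≤ n → ∀ {q} → IsLinear leftModule q →
      (∀ w → X w ≡ q w * + n + k * Y w) → ∃[ p ] GoodForm p × Fits M K p
    nonzeroResidueFits n ε h k ε≤1 n≡ k≢0 ∣k∣<n-ε {q} lq X≡ =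
      shiftedForm ε n k , shifted-good ε≤1 k≢0 ∣k∣<n-ε (4∣n²-ε ε h ε≤1 n≡) , record
      { a-linear = scale-linear (+ ε) lq ; c-linear = zero-linear ; x-linear = lq ; y-linear = lY
      ; isometric = λ u w → trans (substituted X≡ (λ _ → refl) u w)
          (trans (identity M (+ n) k (+ ε) (q u) (q w) (Y u) (Y w))
            (cong (λ i → form (baseForm M) (+ ε * q u) 0ℤ (+ ε * q w) 0ℤ +
                form (gram (+ n * + n - i) (+ n * k) (k * k + M)) (q u) (Y u) (q w) (Y w))
              (idempotent ε≤1)))
      }
      where
      idempotent : ∀ {ε} → ε ℕ.≤ 1 → + ε * + ε ≡ + ε
      idempotent z≤n       = refl
      idempotent (s≤s z≤n) = refl
      identity : ∀ M n k e q q′ Y Y′ → (q * n + k * Y) * (q′ * n + k * Y′) + M * (Y * Y′) ≡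
        1ℤ * (e * q * (e * q′)) + 0ℤ * (e * q * 0ℤ + 0ℤ * (e * q′)) + (M - 1ℤ) * (0ℤ * 0ℤ) +
        ((n * n - e * e) * (q * q′) + n * k * (q * Y′ + Y * q′) + (k * k + M) * (Y * Y′))
      identity = solve-∀

    -- Residue 0 splits by the parity of n: n² is divisible by 4 when n is even, and otherwise q + Y
    -- goes into the coordinate of norm 1, leaving `unshiftedForm`. Nonzero residues use
    -- `shiftedForm`.
    residueFits : ∀ n → 2 ℕ.≤ n → ∀ r → r ℕ.< n → ∀ {q} → IsLinear leftModule q →
      (∀ w → X w ≡ q w * + n + + r * Y w) → ∃[ p ] GoodForm p × Fits M K p
    residueFits n 2≤n r r<n {q} lq X≡ with parity n
    residueFits n 2≤n zero r<n {q} lq X≡ | zero , h , ε≤1 , n≡ =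
      zeroResidueFits n lq X≡ (scaled-good-∣ 0<n²
        (subst (+ 4 ∣_) (ℤ.+-identityʳ (+ n * + n)) (4∣n²-ε 0 h ε≤1 n≡)))
      where
      0<n² : 0ℤ < + n * + n
      0<n² = ℤ.<-≤-trans {0ℤ} {+ 4} (+<+ (s≤s z≤n)) (∣∣≤⇒square≤ (+ 2) (+ n) 2≤n)
    residueFits n 2≤n zero r<n {q} lq X≡ | suc zero , h , ε≤1 , n≡ with m ℕ.≤? 2
    -- For m = 2 the number m - 1 is not good, which rules out `unshiftedForm`, but n² ≥ 4 already
    -- exceeds m.
    ... | yes m≤2 = zeroResidueFits n lq X≡ (scaled-good-< (ℤ.≤-<-trans (+≤+ m≤2)
            (ℤ.<-≤-trans {+ 2} {+ 4} (+<+ (s≤s (s≤s (s≤s z≤n)))) (∣∣≤⇒square≤ (+ 2) (+ n) 2≤n))))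
    ... | no m≰2 = unshiftedForm n ,
      unshifted-good (odd≥3 n h 2≤n n≡) (ℕ.≰⇒> m≰2) (4∣n²-ε 1 h ε≤1 n≡) , record
      { a-linear = +-linear lq lY ; c-linear = zero-linear ; x-linear = lq ; y-linear = lY
      ; isometric = λ u w → trans (substituted X≡ (λ _ → refl) u w)
          (identity M (+ n) (q u) (q w) (Y u) (Y w))
      }
      where
      identity : ∀ M n q q′ Y Y′ → (q * n + 0ℤ * Y) * (q′ * n + 0ℤ * Y′) + M * (Y * Y′) ≡
        1ℤ * ((q + Y) * (q′ + Y′)) + 0ℤ * ((q + Y) * 0ℤ + 0ℤ * (q′ + Y′)) + (M - 1ℤ) * (0ℤ * 0ℤ) +
        ((n * n - 1ℤ) * (q * q′) + - 1ℤ * (q * Y′ + Y * q′) + (M - 1ℤ) * (Y * Y′))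
      identity = solve-∀
    residueFits n 2≤n zero r<n lq X≡ | suc (suc _) , h , s≤s () , n≡
    residueFits n 2≤n r@(suc _) r<n {q} lq X≡ | ε , h , ε≤1 , n≡ with r ℕ.+ suc ε ℕ.≤? n
    ... | yes r+1+ε≤n = nonzeroResidueFits n ε h (+ r) ε≤1 n≡ (λ ()) r+1+ε≤n lq X≡
    -- For even n the failed bound is r + 1 ≤ n, which is `r<n`.
    residueFits n 2≤n r@(suc _) r<n {q} lq X≡ | zero , h , ε≤1 , n≡ | no r+1≰n =
      contradiction (subst (ℕ._≤ n) (ℕ.+-comm 1 r) r<n) r+1≰n
    residueFits n 2≤n r@(suc _) r<n lq X≡ | suc (suc _) , h , s≤s () , n≡ | no _
    -- The residue n − 1 of an odd n is too large for shifted-good, so −1 replaces it.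
    residueFits n 2≤n r@(suc _) r<n {q} lq X≡ | suc zero , h , ε≤1 , n≡ | no r+2≰n =
      nonzeroResidueFits n 1 h (- 1ℤ) ε≤1 n≡ (λ ()) (odd≥3 n h 2≤n n≡) (+-linear lq lY) λ w →
        trans (X≡ w) (subst (λ n → q w * + n + + r * Y w ≡ (q w + Y w) * + n + - 1ℤ * Y w) 1+r≡n
          (identity (q w) (+ r) (Y w)))
      where
      1+r≡n : suc r ≡ n
      1+r≡n = ℕ.≤-antisym r<n (ℕ.≤-pred (subst (n ℕ.<_) (ℕ.+-comm r 2) (ℕ.≰⇒> r+2≰n)))
      identity : ∀ q r Y → q * (1ℤ + r) + r * Y ≡ (q + Y) * (1ℤ + r) + - 1ℤ * Y
      identity = solve-∀

    congruenceFits : Congruence leftModule X Y → ∃[ p ] GoodForm p × Fits M K p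
    congruenceFits (Y-multiple n 2≤n q lq Y≡) =
      -- X goes to the coordinate of norm 1, and mY² = n²m · q² with n²m > m.
      gram (+ n * + n * M) 0ℤ (+ n * + n * M) , scaled-good-< M<n²M , record
      { a-linear = lX ; c-linear = zero-linear ; x-linear = lq ; y-linear = zero-linear
      ; isometric = λ u w → trans (substituted (λ _ → refl) Y≡ u w)
          (identity M (+ n) (X u) (X w) (q u) (q w))
      }
      where
      M<n²M : M < + n * + n * M
      M<n²M = subst (_< + n * + n * M) (ℤ.*-identityˡ M)
        (ℤ.*-monoʳ-<-pos M {{positive (+<+ (ℕ.<⇒≤ 2≤m))}}
          (ℤ.<-≤-trans {1ℤ} {+ 4} (+<+ (s≤s (s≤s z≤n))) (∣∣≤⇒square≤ (+ 2) (+ n) 2≤n)))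
      identity : ∀ M n X X′ q q′ → X * X′ + M * (q * n * (q′ * n)) ≡
        1ℤ * (X * X′) + 0ℤ * (X * 0ℤ + 0ℤ * X′) + (M - 1ℤ) * (0ℤ * 0ℤ) +
        (n * n * M * (q * q′) + 0ℤ * (q * 0ℤ + 0ℤ * q′) + n * n * M * (0ℤ * 0ℤ))
      identity = solve-∀
    congruenceFits (X-residue n@(suc _) 2≤n k q lq X≡) =
      -- Only k modulo n matters: the multiple of n in k is absorbed into the quotient.
      residueFits n 2≤n (k %ℕ n) (n%ℕd<d k n) (+-linear lq (scale-linear (k /ℕ n) lY)) λ w →
        trans (X≡ w) (trans (cong (λ i → q w * + n + i * Y w) (a≡a%ℕn+[a/ℕn]*n k n))
          (identity (q w) (+ n) (+ (k %ℕ n)) (k /ℕ n) (Y w)))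
      where
      identity : ∀ q n r s Y → q * n + (r + s * n) * Y ≡ (q + s * Y) * n + r * Y
      identity = solve-∀

  -- Nonrepresentation of ⟨1, m⟩ by the overlattice.

  private
    base-positive : NormsIn (0ℤ <_) (baseForm M)
    base-positive x y xy≢0 = subst (0ℤ <_) (sym (identity M x y))
      (ℤ.+-mono-<-≤ (0<sumOfSquares x y xy≢0)
        (0≤* (ℤ.i≤j⇒0≤j-i (+≤+ 2≤m)) (square-nonNegative y)))
      where
      identity : ∀ M x y → 1ℤ * (x * x) + 0ℤ * (x * y + y * x) + (M - 1ℤ) * (y * y) ≡
        x * x + y * y + (M - + 2) * (y * y)
      identity = solve-∀

    base-nonNegative : ∀ x y → 0ℤ ≤ norm (baseForm M) x y
    base-nonNegative x y with x ℤ.≟ 0ℤ ×-dec y ℤ.≟ 0ℤ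
    ... | yes (refl , refl) = ℤ.≤-reflexive (sym (form-zero (baseForm M)))
    ... | no xy≢0 = ℤ.<⇒≤ (base-positive x y xy≢0)

    -- Brahmagupta's identity for the norm x² + (m − 1)y².
    orthogonal-norm : ∀ a c a′ c′ → norm (baseForm M) a c ≡ 1ℤ →
      form (baseForm M) a c a′ c′ ≡ 0ℤ →
      norm (baseForm M) a′ c′ ≡ (M - 1ℤ) * ((a * c′ - c * a′) * (a * c′ - c * a′))
    orthogonal-norm a c a′ c′ unit orthogonal = begin
      norm h a′ c′              ≡⟨ ℤ.*-identityˡ _ ⟨
      1ℤ * norm h a′ c′         ≡⟨ cong (_* norm h a′ c′) unit ⟨
      norm h a c * norm h a′ c′ ≡⟨ identity M a c a′ c′ ⟩
      form h a c a′ c′ * form h a c a′ c′ + (M - 1ℤ) * (z * z)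
        ≡⟨ cong (λ i → i * i + (M - 1ℤ) * (z * z)) orthogonal ⟩
      0ℤ + (M - 1ℤ) * (z * z)   ≡⟨ ℤ.+-identityˡ _ ⟩
      (M - 1ℤ) * (z * z)        ∎
      where
      open ≡-Reasoning
      h = baseForm M
      z = a * c′ - c * a′
      identity : ∀ M a c a′ c′ →
        (1ℤ * (a * a) + 0ℤ * (a * c + c * a) + (M - 1ℤ) * (c * c)) *
        (1ℤ * (a′ * a′) + 0ℤ * (a′ * c′ + c′ * a′) + (M - 1ℤ) * (c′ * c′)) ≡
        (1ℤ * (a * a′) + 0ℤ * (a * c′ + c * a′) + (M - 1ℤ) * (c * c′)) *
        (1ℤ * (a * a′) + 0ℤ * (a * c′ + c * a′) + (M - 1ℤ) * (c * c′)) +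
        (M - 1ℤ) * ((a * c′ - c * a′) * (a * c′ - c * a′))
      identity = solve-∀

    -- A good `N` is at least 1, so the equation would force N = 1. Hence a vector of norm 1 has no
    -- component outside ⟨1, m - 1⟩.
    unit-complement : ∀ {h N} → 0ℤ ≤ h → h + N ≡ 1ℤ → ¬ Good N
    unit-complement {h} {N} 0≤h h+N≡1 gN = 1-notGood (subst Good
      (ℤ.≤-antisym
        (subst₂ _≤_ (ℤ.+-identityˡ N) h+N≡1 (ℤ.+-monoˡ-≤ N 0≤h))
        (ℤ.i<j⇒suc[i]≤j (Good⇒0< gN)))
      gN)

    -- For z = 0 the equation gives N = m, and for z = ±1 it gives N = 1; neither is zero or good.
    -- For ∣z∣ ≥ 2 the first term alone exceeds m.
    m-complement : ∀ z {N} → N ≡ 0ℤ ⊎ Good N → ¬ (M - 1ℤ) * (z * z) + N ≡ M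
    m-complement z {N} N∈ eq with z ℤ.≟ 0ℤ
    m-complement z {N} N∈ eq | yes refl = notM N∈
      where
      N≡M : N ≡ M
      N≡M = trans (sym (ℤ.+-identityˡ N)) (trans (cong (_+ N) (sym (ℤ.*-zeroʳ (M - 1ℤ)))) eq)
      notM : ¬ (N ≡ 0ℤ ⊎ Good N)
      notM (inj₁ N≡0) = ℕ.<⇒≢ (ℕ.<⇒≤ 2≤m) (sym (ℤ.+-injective (trans (sym N≡M) N≡0)))
      notM (inj₂ gN)  = m-notGood (subst Good N≡M gN)
    m-complement z {N} N∈ eq | no z≢0 with square≡1⊎2≤∣∣ z z≢0
    ... | inj₁ z²≡1 = not1 N∈
      where
      cancel : ∀ M N → N ≡ (M - 1ℤ) * 1ℤ + N - M + 1ℤ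
      cancel = solve-∀
      M-M+1 : ∀ M → M - M + 1ℤ ≡ 1ℤ
      M-M+1 = solve-∀
      N≡1 : N ≡ 1ℤ
      N≡1 = trans (cancel M N) (trans
        (cong (λ i → i - M + 1ℤ) (trans (cong (λ s → (M - 1ℤ) * s + N) (sym z²≡1)) eq)) (M-M+1 M))
      not1 : ¬ (N ≡ 0ℤ ⊎ Good N)
      not1 (inj₁ N≡0) = contradiction (trans (sym N≡0) N≡1) λ ()
      not1 (inj₂ gN)  = 1-notGood (subst Good N≡1 gN)
    ... | inj₂ 2≤∣z∣ = ℤ.<-irrefl (sym eq) (<-offset _ (identity M (z * z) N)
      (ℤ.+-mono-≤-< (ℤ.+-mono-≤ (ℤ.+-mono-≤
        (0≤* (ℤ.i≤j⇒0≤j-i (+≤+ (ℕ.<⇒≤ 2≤m))) (0≤square-4 {z} 2≤∣z∣))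
        (0≤N N∈))
        (0≤* {+ 3} (+≤+ z≤n) (ℤ.i≤j⇒0≤j-i (+≤+ 2≤m))))
        (+<+ {0} {2} (s≤s z≤n))))
      where
      0≤N : N ≡ 0ℤ ⊎ Good N → 0ℤ ≤ N
      0≤N (inj₁ refl) = ℤ.≤-refl
      0≤N (inj₂ gN)   = ℤ.<⇒≤ (Good⇒0< gN)
      identity : ∀ M s N → (M - 1ℤ) * s + N ≡
        M + ((M - 1ℤ) * (s - + 4) + N + + 3 * (M - + 2) + + 2)
      identity = solve-∀

  module _ {t} (ps : Vector Gram t) (good : ∀ i → GoodForm (ps i)) where
    private
      pieces : Vector Gram (suc t)
      pieces = baseForm M ∷ ps

      pieces-positive : ∀ i → NormsIn (0ℤ <_) (pieces i)
      pieces-positive zero            = base-positive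
      pieces-positive (suc i) x y xy≢0 = Good⇒0< (good i x y xy≢0)

    overlattice : ℤ-Lattice
    overlattice = orthogonalSum pieces pieces-positive

    Fits⇒Representation : ∀ {K} i → Fits M K (ps i) → Representation K overlattice
    Fits⇒Representation i fits = record
      { σ = λ w → a w ∷ c w ∷ inject i (x w) (y w)
      ; isLeftModuleHomomorphism = vector-homomorphism λ where
          zero          → a-linear
          (suc zero)    → c-linear
          (suc (suc j)) → inject-linear i x-linear y-linear j
      ; B-homo = λ u w → trans
          (cong (λ i → form (baseForm M) (a u) (c u) (a w) (c w) + i)
            (gramForm-inject ps i (x u) (y u) (x w) (y w)))
          (sym (isometric u w))
      }
      where open Fits fits

    -- Once the image `u` of the norm 1 vector lies in ⟨1, m - 1⟩, orthogonality of `w` to `u`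
    -- concerns only the first two coordinates. `orthogonal-norm` then applies without solving for
    -- `u`, which also covers m = 2, where ⟨1, 1⟩ has unit vectors on both axes.
    ¬Representation : .{{_ : NonZero m}} → ¬ Representation ⟨ 1 , m ⟩ overlattice
    ¬Representation ρ with gramForm-norms {Good} Good-+ ps good
      (tail (tail (Representation.σ ρ (standardBasis zero))))
    ... | inj₂ gU = unit-complement (base-nonNegative (u zero) (u (suc zero)))
            (trans (B-homo e₁ e₁) (identity M)) gU
      where
      open Representation ρ
      e₁ : Vector ℤ 2
      e₁ = standardBasis zero
      u : Vector ℤ (suc t ℕ.* 2)
      u = σ e₁
      identity : ∀ M → 1ℤ * (1ℤ * 1ℤ) + (M * (0ℤ * 0ℤ) + 0ℤ) ≡ 1ℤ
      identity = solve-∀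
    -- The determinant of the ⟨1, m - 1⟩ components of `u` and `w` is the z of `orthogonal-norm`.
    ... | inj₁ U≡0 = m-complement (u zero * w (suc zero) - u (suc zero) * w zero) N-norm
            (trans (cong (_+ N) (sym (orthogonal-norm (u zero) (u (suc zero)) (w zero) (w (suc zero))
              (trans (drop-U u) (trans (B-homo e₁ e₁) (identity₁₁ M)))
              (trans (drop-U w) (trans (B-homo e₁ e₂) (identity₁₂ M))))))
            (trans (B-homo e₂ e₂) (identity₂₂ M)))
      where
      open Representation ρ
      e₁ e₂ : Vector ℤ 2
      e₁ = standardBasis zero
      e₂ = standardBasis (suc zero)
      u w : Vector ℤ (suc t ℕ.* 2)
      u = σ e₁
      w = σ e₂
      N : ℤ
      N = gramForm ps (tail (tail w)) (tail (tail w))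
      drop-U : ∀ v → form (baseForm M) (u zero) (u (suc zero)) (v zero) (v (suc zero)) ≡ gramForm pieces u v
      drop-U v = trans (sym (ℤ.+-identityʳ _))
        (cong (λ i → form (baseForm M) (u zero) (u (suc zero)) (v zero) (v (suc zero)) + i)
          (sym (gramForm-zeroˡ ps (tail (tail v)) U≡0)))
      N-norm : N ≡ 0ℤ ⊎ Good N
      N-norm with gramForm-norms {Good} Good-+ ps good (tail (tail w))
      ... | inj₁ W≡0 = inj₁ (gramForm-zeroˡ ps (tail (tail w)) W≡0)
      ... | inj₂ gN  = inj₂ gN
      identity₁₁ : ∀ M → 1ℤ * (1ℤ * 1ℤ) + (M * (0ℤ * 0ℤ) + 0ℤ) ≡ 1ℤ
      identity₁₁ = solve-∀
      identity₁₂ : ∀ M → 1ℤ * (1ℤ * 0ℤ) + (M * (0ℤ * 1ℤ) + 0ℤ) ≡ 0ℤ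
      identity₁₂ = solve-∀
      identity₂₂ : ∀ M → 1ℤ * (0ℤ * 0ℤ) + (M * (1ℤ * 1ℤ) + 0ℤ) ≡ M
      identity₂₂ = solve-∀

  -- From proper sublattices to the theorem.

  -- The two coordinates of `ι` are linear, and if they jointly reached every pair of integers `ι`
  -- would be onto. The double negation comes from the classical choice of the modulus.
  properSublattice-fits : .{{_ : NonZero m}} → (P : ProperSublattice ⟨ 1 , m ⟩) →
    ¬ ¬ (∃[ p ] GoodForm p × Fits M (ProperSublattice.lattice P) p)
  properSublattice-fits P = ¬¬-map
    (congruenceFits lattice (coordinate zero) (coordinate (suc zero)) isometry)
    (proper⇒congruence (coordinate zero) (coordinate (suc zero)) λ onto → proper λ v →
      let w , Xw≡ , Yw≡ = onto (v zero) (v (suc zero)) in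
      w , λ u≈w → λ where
        zero       → trans (⟦⟧-cong u≈w zero) Xw≡
        (suc zero) → trans (⟦⟧-cong u≈w (suc zero)) Yw≡)
    where
    open ProperSublattice P
    open ℤ-Lattice lattice using (leftModule; B)
    open IsLeftModuleMonomorphism isLeftModuleMonomorphism using (⟦⟧-cong; +ᴹ-homo; *ₗ-homo)

    coordinate : ∀ j → IsLinear leftModule (λ w → ι w j)
    coordinate j = record
      { cong-≈ = λ u≈w → ⟦⟧-cong u≈w j
      ; +-homo = λ u w → +ᴹ-homo u w j
      ; *-homo = λ c u → *ₗ-homo c u j
      }

    isometry : ∀ u w → B u w ≡ ι u zero * ι w zero + M * (ι u (suc zero) * ι w (suc zero))
    isometry u w = trans (sym (B-homo u w))
      (identity M (ι u zero * ι w zero) (ι u (suc zero) * ι w (suc zero)))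
      where
      identity : ∀ M i j → 1ℤ * i + (M * j + 0ℤ) ≡ i + M * j
      identity = solve-∀

proposition4p3 : (m : ℕ) → .{{_ : NonZero m}} → m % 4 ≡ 2 → ¬ Recoverable ⟨ 1 , m ⟩
proposition4p3 m m%4≡2 (t , ℓᵢ , recovers) =
  -- The goal is empty, so the forms `p` may be taken as given for all the sublattices at once.
  ¬¬-Π (λ i → properSublattice-fits m 2≤m 4∤m (ℓᵢ i)) λ fits →
    let ps   = λ i → proj₁ (fits i)
        good = λ i → proj₁ (proj₂ (fits i))
    in ¬Representation m 2≤m 4∤m ps good
         (recovers (overlattice m 2≤m 4∤m ps good)
           (λ i → Fits⇒Representation m 2≤m 4∤m ps good i (proj₂ (proj₂ (fits i)))))
  where
  2≤m : 2 ℕ.≤ m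
  2≤m = subst (ℕ._≤ m) m%4≡2 (ℕ.m%n≤m m 4)
  4∤m : ¬ 4 ℕ.∣ m
  4∤m 4∣m = contradiction (trans (sym (ℕ.n∣m⇒m%n≡0 m 4 4∣m)) m%4≡2) λ ()
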